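{- Let $\mathcal{S}$ be a relational structure admitting an injective unary FA-presentation $(a^*,\phi)$, and let $R$ be a binary relation in the signature of $\mathcal{S}$. Let $R^+$ denote the transitive closure of $R$. Then $\Lambda(R^+,\phi)=\{(u,v)\in a^*\times a^* : (u\phi,v\phi)\in R^+\}$ is regular. Hence $\mathcal{S}$ augmented by the relation $R^+$ is also unary FA-presentable.
   Context: For words $w_1,\dots,w_r$ over a finite alphabet $A$, $\mathrm{conv}(w_1,\dots,w_r)$ is the word over $(A\cup\{\$\})^r$ (with $\$\notin A$) whose $j$-th letter is the tuple of $j$-th letters of the $w_i$, shorter words being padded at the end with $\$$. A relation $X\subseteq (A^*)^r$ is regular if $\{\mathrm{conv}(w_1,\dots,w_r):(w_1,\dots,w_r)\in X\}$ is a regular language. An FA-presentation of a relational structure $\mathcal{S}=(S,R_1,\dots,R_n)$ is a pair $(L,\phi)$ with $L$ a regular language over a finite alphabet and $\phi:L\to S$ surjective such that for every relation $R\in\{=,R_1,\dots,R_n\}$ of arity $r$ the relation $\Lambda(R,\phi)=\{(w_1,\dots,w_r)\in L^r : R(w_1\phi,\dots,w_r\phi)\}$ is regular. It is unary if $L$ is over a one-letter alphabet $\{a\}$; a structure is unary FA-presentable if it admits a unary FA-presentation. An injective unary FA-presentation $(a^*,\phi)$ is one with $L=a^*$ and $\phi$ injective. -}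

module Defs where

open import Data.Fin.Base using (Fin)
open import Data.Fin.Subset using (Subset) renaming (_∈_ to _∈ₛ_)
open import Data.Irrelevant using ([_])
open import Data.List.Base using (List; []; _∷_; applyUpTo; drop; foldl; head; length)
open import Data.List.Membership.Propositional using (_∈_)
open import Data.Maybe.Base using (Maybe)
open import Data.Nat.Base using (ℕ; _⊔_)
open import Data.Product.Base using (Σ-syntax; ∃-syntax; _×_; _,_)
open import Data.Refinement.Base using (Refinement; _,_)
open import Data.Vec.Base as Vec using (Vec; []; _∷_)
open import Data.Vec.Relation.Unary.All using (All; reduce)
open import Function.Bundles using (_⇔_)
open import Function.Definitions using (Surjective)
open import Level using (Level; 0ℓ) renaming (suc to lsuc)
open import Relation.Binary.Construct.Closure.Transitive using (TransClosure)
open import Relation.Binary.Core using (Rel)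
open import Relation.Binary.PropositionalEquality.Core using (_≡_)
open import Relation.Unary using (Pred)

private
  variable
    ℓ : Level
    k r : ℕ

record DFA (A : Set) : Set where
  field
    states : ℕ
    start  : Fin states
    step   : Fin states → A → Fin states
    final  : Subset states

  Accepts : Pred (List A) 0ℓ
  Accepts w = foldl step start w ∈ₛ final

-- Only ever used at the finite alphabets Fin k and Vec (Maybe (Fin k)) r.
Regular : {A : Set} → Pred (List A) ℓ → Set ℓ
Regular {A = A} K = Σ[ M ∈ DFA A ] (∀ w → K w ⇔ DFA.Accepts M w)

Word : ℕ → Set
Word k = List (Fin k)

-- The padding symbol $ is nothing; positions j are counted from 0.
letter : ℕ → Word k → Maybe (Fin k)
letter j w = head (drop j w)

conv : Vec (Word k) r → List (Vec (Maybe (Fin k)) r)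
conv ws = applyUpTo (λ j → Vec.map (letter j) ws) (Vec.foldr′ _⊔_ 0 (Vec.map length ws))

RegularRelation : Pred (Vec (Word k) r) ℓ → Set ℓ
RegularRelation X = Regular (λ u → ∃[ ws ] (X ws × conv ws ≡ u))

Relation : Set ℓ → Set (lsuc ℓ)
Relation {ℓ} S = Σ[ r ∈ ℕ ] Pred (Vec S r) ℓ

record Structure (ℓ : Level) : Set (lsuc ℓ) where
  field
    Carrier   : Set ℓ
    relations : List (Relation Carrier)

open Structure public

binary : {S : Set ℓ} → Rel S ℓ → Pred (Vec S 2) ℓ
binary _∼_ (x ∷ y ∷ []) = x ∼ y

_⁺ : {S : Set ℓ} → Pred (Vec S 2) ℓ → Pred (Vec S 2) ℓ
R ⁺ = binary (TransClosure (λ x y → R (x ∷ y ∷ [])))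

augment : (𝒮 : Structure ℓ) → Relation (Carrier 𝒮) → Structure ℓ
augment 𝒮 R = record { Carrier = Carrier 𝒮 ; relations = R ∷ relations 𝒮 }

-- Refinement makes membership in L proof-irrelevant, so that φ is a function
-- of the word alone.
Λ : {S : Set ℓ} {L : Pred (Word k) 0ℓ} →
    Pred (Vec S r) ℓ → (Refinement (Word k) L → S) → Pred (Vec (Word k) r) ℓ
Λ {L = L} R φ ws = Σ[ ws∈L ∈ All L ws ] R (reduce (λ {w} w∈L → φ (w , [ w∈L ])) ws∈L)

record FAPresentation (k : ℕ) (𝒮 : Structure ℓ) : Set (lsuc ℓ) where
  field
    L            : Pred (Word k) 0ℓ
    L-regular    : Regular L
    φ            : Refinement (Word k) L → Carrier 𝒮
    φ-surjective : Surjective _≡_ _≡_ φ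
    Λ-regular    : ∀ {r} {R : Pred (Vec (Carrier 𝒮) r) ℓ} →
                   (r , R) ∈ (2 , binary _≡_) ∷ relations 𝒮 →
                   RegularRelation (Λ R φ)

UnaryFAPresentation : Structure ℓ → Set (lsuc ℓ)
UnaryFAPresentation = FAPresentation 1

UnaryFAPresentable : Structure ℓ → Set (lsuc ℓ)
UnaryFAPresentable 𝒮 = UnaryFAPresentation 𝒮

{-# OPTIONS --safe #-}
-- Identify a^m with m.  For v < t, whether v → t and whether t → v are edges is
-- decided by the states that the automaton of R reaches on conv(a^v, a^t) and
-- conv(a^t, a^v); take these two states as the label of v at time t.  Labels have
-- finitely many values, evolve independently of v, and determine all edges between
-- v and the vertices that are still to come.  Hence, for reachability, the graph
-- induced on {0, …, t − 1} may be replaced by the finite set of those label pairs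
-- (l, l′) for which some vertex labelled l reaches some vertex labelled l′ : a path
-- using a new vertex may be taken to visit it once, so inserting the vertex t
-- updates this set as a function of the set itself.  Marking x and y in the labels,
-- an automaton reading conv(a^x, a^y) maintains the set, and at the end of the word
-- it remains to decide whether a fixed self-map of a finite set ever leads to a
-- set that connects the marks.  To get R⁺ rather than R*, the mark of y is put on an
-- additional copy of y with the same edges, so that paths from x to it are nonempty.
module Submission where

open import Defs
open import Data.Bool.Base using (Bool; true; false; if_then_else_)
open import Data.Empty using (⊥; ⊥-elim)
open import Data.Fin.Base using (Fin; zero; suc; toℕ; fromℕ<; combine; remQuot; finToFun; funToFin)
open import Data.Fin.Patterns using (0F; 1F; 2F; 3F)
open import Data.Fin.Properties using (_≟_; any?; pigeonhole; toℕ<n; toℕ-fromℕ<; remQuot-combine; finToFun-funToFin; *↔×)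
open import Data.Fin.Subset using (Subset) renaming (_∈_ to _∈ₛ_)
open import Data.Fin.Subset.Properties using () renaming (_∈?_ to _∈ₛ?_)
open import Data.Irrelevant using ([_])
open import Data.List.Base using (List; []; _∷_; applyUpTo; foldl; length; replicate)
open import Data.List.Membership.Propositional using (_∈_)
open import Data.List.Properties using (∷-injectiveʳ)
open import Data.List.Relation.Unary.Any using (here; there)
open import Data.Maybe.Base using (Maybe; just; nothing)
open import Data.Nat.Base using (ℕ; zero; suc; _+_; _∸_; _^_; _*_; _≤_; _<_; _⊔_; _≡ᵇ_; z≤n; s≤s)
open import Data.Nat.GeneralisedArithmetic using (iterate)
open import Data.Nat.Induction using (<-rec)
open import Data.Nat.Properties using (_<?_; ≮⇒≥; ≤-trans; <⇒≤; m≤n⇒m<n∨m≡n; m<n⇒m<1+n; n<1+n; m≤n+m; m≤m⊔n; m≤n⊔m; m+[n∸m]≡n; +-monoˡ-<; ⊔-identityʳ; ≡ᵇ⇒≡; ≡⇒≡ᵇ)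
open import Data.Product.Base using (_×_; _,_; proj₁; proj₂; ∃-syntax; ∃₂)
open import Data.Product.Function.NonDependent.Propositional using (_×-↔_)
open import Data.Refinement.Base using (_,_)
open import Data.Sum.Base using (_⊎_; inj₁; inj₂)
open import Data.Vec.Base as Vec using (Vec; []; _∷_)
open import Data.Vec.Properties using ([]=⇒lookup; lookup⇒[]=; lookup∘tabulate)
open import Data.Vec.Relation.Unary.All using ([]; _∷_)
open import Function.Base using (_∘_; case_of_; const)
open import Function.Bundles using (_⇔_; mk⇔; Equivalence; _↔_; Inverse; Injection)
open import Function.Construct.Composition using (_↔-∘_)
open import Function.Construct.Symmetry using (↔-sym; ⇔-sym)
open import Function.Construct.Identity using (↔-id; ⇔-id)
open import Function.Definitions using (Injective)
open import Function.Properties.Inverse using (↔⇒↣)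
open import Level using (Level; 0ℓ)
open import Relation.Binary.Construct.Closure.Transitive using (TransClosure; [_]; _∷_)
open import Relation.Binary.Core using (Rel)
open import Relation.Binary.PropositionalEquality.Core using (_≡_; _≢_; refl; sym; trans; cong; cong₂; subst)
open import Relation.Nullary.Decidable using (Dec; yes; no; does; map′; _×-dec_; _⊎-dec_; dec-true)
open import Relation.Nullary.Negation using (contradiction)
open import Relation.Unary using (Pred; Universal; Decidable)

open Equivalence using (to; from)

private
  variable
    a ℓ ℓ′ : Level
    n : ℕ
    S : Set

-- Finite automata

reflects : {A : Set a} (a? : Dec A) → does a? ≡ true ⇔ A
reflects (yes p) = mk⇔ (const p) (const refl)
reflects (no ¬p) = mk⇔ (λ ()) (λ p → dec-true (no ¬p) p)

subset : {P : Pred (Fin n) 0ℓ} → Decidable P → Subset n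
subset P? = Vec.tabulate (λ i → does (P? i))

∈-subset : {P : Pred (Fin n) 0ℓ} (P? : Decidable P) → ∀ i → i ∈ₛ subset P? ⇔ P i
∈-subset P? i = mk⇔
  (λ i∈ → to (reflects (P? i)) (trans (sym (lookup∘tabulate _ i)) ([]=⇒lookup i∈)))
  (λ p → lookup⇒[]= i _ (trans (lookup∘tabulate _ i) (from (reflects (P? i)) p)))

Regular-cong : {A : Set} {K : Pred (List A) ℓ} {K′ : Pred (List A) ℓ′} →
               (∀ w → K w ⇔ K′ w) → Regular K → Regular K′
Regular-cong K⇔K′ (M , K⇔M) = M , λ w → mk⇔ (to (K⇔M w) ∘ from (K⇔K′ w)) (to (K⇔K′ w) ∘ from (K⇔M w))

-- Automata below have structured states, such as pairs with a `FinRel`. The bijection transports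
-- them to the numbered states of a `DFA`, and decidability turns acceptance into a subset.
finiteStateRegular : {A : Set} → S ↔ Fin n → (s₀ : S) (δ : S → A → S) {F : Pred S 0ℓ} →
                     Decidable F → Regular (λ w → F (foldl δ s₀ w))
finiteStateRegular {S = S} {n = n} {A = A} S↔Fin s₀ δ {F} F? = M , λ w → mk⇔
  (λ f → from (∈-subset (F? ∘ dec) _) (subst F (sym (decode s₀ w)) f))
  (λ f → subst F (decode s₀ w) (to (∈-subset (F? ∘ dec) _) f))
  where
  enc : S → Fin n
  enc = Inverse.to S↔Fin
  dec : Fin n → S
  dec = Inverse.from S↔Fin
  M : DFA A
  M = record { states = n ; start = enc s₀ ; step = λ i a → enc (δ (dec i) a) ; final = subset (F? ∘ dec) }
  decode : ∀ s w → dec (foldl (DFA.step M) (enc s) w) ≡ foldl δ s w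
  decode s []      = Inverse.strictlyInverseʳ S↔Fin s
  decode s (a ∷ w) rewrite Inverse.strictlyInverseʳ S↔Fin s = decode (δ s a) w

iterate-+ : (f : S → S) (s : S) → ∀ i j → iterate f s (i + j) ≡ iterate f (iterate f s i) j
iterate-+ f s zero    j = refl
iterate-+ f s (suc i) j = iterate-+ f (f s) i j

module _ (S↔Fin : S ↔ Fin n) (f : S → S) {P : Pred S 0ℓ} (P? : Decidable P) (s : S) where

  -- Two of the iterates numbered 0 to `n` coincide. For `k` beyond `n`, cutting out the cycle
  -- between these two gives an earlier visit. Hence a search up to `n` decides whether `P` is ever
  -- visited.
  visit-early : ∀ k → P (iterate f s k) → ∃[ i ] P (iterate f s (toℕ {suc n} i))
  visit-early = <-rec _ visit
    where
    visit : ∀ k → (∀ {j} → j < k → P (iterate f s j) → ∃[ i ] P (iterate f s (toℕ {suc n} i))) →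
            P (iterate f s k) → ∃[ i ] P (iterate f s (toℕ {suc n} i))
    visit k rec p with k <? suc n
    ... | yes k<1+n = fromℕ< k<1+n , subst (P ∘ iterate f s) (sym (toℕ-fromℕ< k<1+n)) p
    ... | no  k≮1+n
      with i , j , i<j , same ← pigeonhole (n<1+n n) (λ (i : Fin (suc n)) → Inverse.to S↔Fin (iterate f s (toℕ i)))
      = rec (subst (toℕ i + r <_) j+r≡k (+-monoˡ-< r i<j)) (subst P skip p)
      where
      r : ℕ
      r = k ∸ toℕ j
      j+r≡k : toℕ j + r ≡ k
      j+r≡k = m+[n∸m]≡n (≤-trans (<⇒≤ (toℕ<n j)) (≮⇒≥ k≮1+n))
      skip : iterate f s k ≡ iterate f s (toℕ i + r)
      skip = trans (cong (iterate f s) (sym j+r≡k))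
               (trans (iterate-+ f s (toℕ j) r)
                 (trans (cong (λ z → iterate f z r) (sym (Injection.injective (↔⇒↣ S↔Fin) same)))
                   (sym (iterate-+ f s (toℕ i) r))))

  visit? : Dec (∃[ k ] P (iterate f s k))
  visit? = map′ (λ (i , p) → toℕ i , p) (λ (k , p) → visit-early k p) (any? (λ i → P? (iterate f s (toℕ {suc n} i))))

-- Convolutions of two unary words

Letter : Set
Letter = Vec (Maybe (Fin 1)) 2

pattern aa = just zero ∷ just zero ∷ []
pattern a$ = just zero ∷ nothing   ∷ []
pattern $a = nothing   ∷ just zero ∷ []
pattern $$ = nothing   ∷ nothing   ∷ []

-- Recursion on both lengths makes runs of automata on convolutions accessible to induction;
-- `conv-word` links this form to `conv`.
conv₂ : ℕ → ℕ → List Letter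
conv₂ zero    zero    = []
conv₂ zero    (suc n) = $a ∷ conv₂ zero n
conv₂ (suc m) zero    = a$ ∷ conv₂ m zero
conv₂ (suc m) (suc n) = aa ∷ conv₂ m n

conv₂-injective : ∀ m n {m′ n′} → conv₂ m n ≡ conv₂ m′ n′ → m ≡ m′ × n ≡ n′
conv₂-injective zero    zero    {zero}   {zero}   _  = refl , refl
conv₂-injective zero    (suc n) {zero}   {suc n′} eq
  with refl , refl ← conv₂-injective zero n (∷-injectiveʳ eq) = refl , refl
conv₂-injective (suc m) zero    {suc m′} {zero}   eq
  with refl , refl ← conv₂-injective m zero (∷-injectiveʳ eq) = refl , refl
conv₂-injective (suc m) (suc n) {suc m′} {suc n′} eq
  with refl , refl ← conv₂-injective m n (∷-injectiveʳ eq) = refl , refl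
conv₂-injective zero    zero    {zero}   {suc _}  ()
conv₂-injective zero    zero    {suc _}  {zero}   ()
conv₂-injective zero    zero    {suc _}  {suc _}  ()
conv₂-injective zero    (suc _) {zero}   {zero}   ()
conv₂-injective zero    (suc _) {suc _}  {zero}   ()
conv₂-injective zero    (suc _) {suc _}  {suc _}  ()
conv₂-injective (suc _) zero    {zero}   {zero}   ()
conv₂-injective (suc _) zero    {zero}   {suc _}  ()
conv₂-injective (suc _) zero    {suc _}  {suc _}  ()
conv₂-injective (suc _) (suc _) {zero}   {zero}   ()
conv₂-injective (suc _) (suc _) {zero}   {suc _}  ()
conv₂-injective (suc _) (suc _) {suc _}  {zero}   ()

word : ℕ → Word 1
word m = replicate m zero

word-surjective : ∀ w → ∃[ m ] word m ≡ w
word-surjective []         = zero , refl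
word-surjective (zero ∷ w) with m , refl ← word-surjective w = suc m , refl

applyUpTo-cong : {A : Set a} {f g : ℕ → A} → (∀ j → f j ≡ g j) → ∀ k → applyUpTo f k ≡ applyUpTo g k
applyUpTo-cong f≗g zero    = refl
applyUpTo-cong f≗g (suc k) = cong₂ _∷_ (f≗g 0) (applyUpTo-cong (f≗g ∘ suc) k)

letter-[] : ∀ j → letter {1} j [] ≡ nothing
letter-[] zero    = refl
letter-[] (suc j) = refl

-- Removing the first letter leaves the convolution of the shortened words. `letter-[]` is needed
-- because `letter j []` is stuck for variable `j`, and `⊔-identityʳ` because the fold in `conv`
-- ends with a maximum with 0.
conv-word : ∀ m n → conv (word m ∷ word n ∷ []) ≡ conv₂ m n
conv-word zero    zero    = refl
conv-word zero    (suc n) = cong ($a ∷_) (trans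
  (trans (applyUpTo-cong (λ j → cong (λ l → l ∷ letter j (word n) ∷ []) (sym (letter-[] j))) _)
         (cong (applyUpTo _) (sym (⊔-identityʳ _))))
  (conv-word zero n))
conv-word (suc m) zero    = cong (a$ ∷_) (trans
  (trans (applyUpTo-cong (λ j → cong (λ l → letter j (word m) ∷ l ∷ []) (sym (letter-[] j))) _)
         (cong (applyUpTo _) (sym (⊔-identityʳ _))))
  (conv-word m zero))
conv-word (suc m) (suc n) = cong (aa ∷_) (trans
  (cong (λ k → applyUpTo (λ j → letter j (word m) ∷ letter j (word n) ∷ []) (length (word m) ⊔ k)) (sym (⊔-identityʳ _)))
  (conv-word m n))

RegularOnℕ : Rel ℕ ℓ → Set ℓ
RegularOnℕ X = Regular (λ w → ∃₂ λ m n → X m n × conv₂ m n ≡ w)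

-- Automata that process the numbers 0, 1, 2, … in turn, being told when x and y come.
module MarkedRun (S↔Fin : S ↔ Fin n) (step : Bool → Bool → S → S) {Goal : Pred S 0ℓ} (Goal? : Decidable Goal) where

  run : (ℕ → Bool) → (ℕ → Bool) → S → ℕ → S
  run isX isY s zero    = s
  run isX isY s (suc t) = run (isX ∘ suc) (isY ∘ suc) (step (isX 0) (isY 0) s) t

  at : ℕ → ℕ → Bool
  at m t = t ≡ᵇ m

  never : ℕ → Bool
  never = const false

  Eventually : Pred S 0ℓ
  Eventually s = ∃[ k ] Goal (run never never s k)

  run-never : ∀ s k → iterate (step false false) s k ≡ run never never s k
  run-never s zero    = refl
  run-never s (suc k) = run-never (step false false s) k

  eventually? : Decidable Eventually
  eventually? s = map′ (λ (k , g) → k , subst Goal (run-never s k) g) (λ (k , g) → k , subst Goal (sym (run-never s k)) g)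
    (visit? S↔Fin (step false false) Goal? s)

  pattern level  = 0F
  pattern xEnded = 1F
  pattern yEnded = 2F
  pattern dead   = 3F

  -- The letter at position `t` decides the marks of the number `t`: a word of length `t` has its
  -- first padding symbol there. Letters that cannot continue a convolution lead to `dead`.
  δ : Fin 4 × S → Letter → Fin 4 × S
  δ (level  , s) aa = level  , step false false s
  δ (level  , s) $a = xEnded , step true  false s
  δ (level  , s) a$ = yEnded , step false true  s
  δ (xEnded , s) $a = xEnded , step false false s
  δ (yEnded , s) a$ = yEnded , step false false s
  δ (_      , s) _  = dead , s

  -- At the end of the word, the next number is the larger one of x and y.
  Final : Pred (Fin 4 × S) 0ℓ
  Final (level  , s) = Eventually (step true  true  s)
  Final (xEnded , s) = Eventually (step false true  s)
  Final (yEnded , s) = Eventually (step true  false s)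
  Final (dead   , s) = ⊥

  final? : Decidable Final
  final? (level  , s) = eventually? (step true  true  s)
  final? (xEnded , s) = eventually? (step false true  s)
  final? (yEnded , s) = eventually? (step true  false s)
  final? (dead   , s) = no λ ()

  -- The count `suc n + k` consists of `n` letters, one step made by `Final` for the number `n`, and
  -- `k` unmarked steps. Since `at (suc n) ∘ suc` computes to `at n`, dropping a letter is just a
  -- shift.
  final-xEnded : ∀ n s → Final (foldl δ (xEnded , s) (conv₂ 0 n)) ⇔ (∃[ k ] Goal (run never (at n) s (suc n + k)))
  final-xEnded zero    s = ⇔-id _
  final-xEnded (suc n) s = final-xEnded n (step false false s)

  final-yEnded : ∀ m s → Final (foldl δ (yEnded , s) (conv₂ m 0)) ⇔ (∃[ k ] Goal (run (at m) never s (suc m + k)))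
  final-yEnded zero    s = ⇔-id _
  final-yEnded (suc m) s = final-yEnded m (step false false s)

  final-level : ∀ m n s → Final (foldl δ (level , s) (conv₂ m n)) ⇔ (∃[ k ] Goal (run (at m) (at n) s (suc (m ⊔ n) + k)))
  final-level zero    zero    s = ⇔-id _
  final-level zero    (suc n) s = final-xEnded n (step true false s)
  final-level (suc m) zero    s = final-yEnded m (step false true s)
  final-level (suc m) (suc n) s = final-level m n (step false false s)

  final-dead : ∀ w s → Final (foldl δ (dead , s) w) → ⊥
  final-dead (aa ∷ w) s = final-dead w s
  final-dead (a$ ∷ w) s = final-dead w s
  final-dead ($a ∷ w) s = final-dead w s
  final-dead ($$ ∷ w) s = final-dead w s

  -- Regularity also demands that words which are not convolutions be rejected; this and the next
  -- two lemmas ensure it.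
  word-xEnded : ∀ w s → Final (foldl δ (xEnded , s) w) → ∃[ n ] conv₂ 0 n ≡ w
  word-xEnded []       s f = 0 , refl
  word-xEnded ($a ∷ w) s f with n , refl ← word-xEnded w _ f = suc n , refl
  word-xEnded (aa ∷ w) s f with () ← final-dead w s f
  word-xEnded (a$ ∷ w) s f with () ← final-dead w s f
  word-xEnded ($$ ∷ w) s f with () ← final-dead w s f

  word-yEnded : ∀ w s → Final (foldl δ (yEnded , s) w) → ∃[ m ] conv₂ m 0 ≡ w
  word-yEnded []       s f = 0 , refl
  word-yEnded (a$ ∷ w) s f with m , refl ← word-yEnded w _ f = suc m , refl
  word-yEnded (aa ∷ w) s f with () ← final-dead w s f
  word-yEnded ($a ∷ w) s f with () ← final-dead w s f
  word-yEnded ($$ ∷ w) s f with () ← final-dead w s f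

  word-level : ∀ w s → Final (foldl δ (level , s) w) → ∃₂ λ m n → conv₂ m n ≡ w
  word-level []       s f = 0 , 0 , refl
  word-level (aa ∷ w) s f with m , n , refl ← word-level w _ f = suc m , suc n , refl
  word-level ($a ∷ w) s f with n , refl ← word-xEnded w _ f = 0 , suc n , refl
  word-level (a$ ∷ w) s f with m , refl ← word-yEnded w _ f = suc m , 0 , refl
  word-level ($$ ∷ w) s f with () ← final-dead w s f

  -- `run` unfolds at its first step, as reading a word does; an invariant in time needs the last
  -- step instead.
  run-suc : ∀ isX isY s t → run isX isY s (suc t) ≡ step (isX t) (isY t) (run isX isY s t)
  run-suc isX isY s zero    = refl
  run-suc isX isY s (suc t) = run-suc (isX ∘ suc) (isY ∘ suc) (step (isX 0) (isY 0) s) t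

  -- Acceptance inspects only times beyond both `x` and `y`. Completeness is therefore required at
  -- all late times, soundness at every time.
  markedRunRegular : {X : Rel ℕ ℓ} (s₀ : S) →
    (∀ x y t → Goal (run (at x) (at y) s₀ t) → X x y) →
    (∀ x y → X x y → ∃[ t₀ ] ∀ t → t₀ ≤ t → Goal (run (at x) (at y) s₀ t)) →
    RegularOnℕ X
  markedRunRegular {X = X} s₀ sound complete =
    Regular-cong accepts (finiteStateRegular (↔-sym *↔× ↔-∘ (↔-id _ ×-↔ S↔Fin)) (level , s₀) δ final?)
    where
    accepts : ∀ w → Final (foldl δ (level , s₀) w) ⇔ (∃₂ λ m n → X m n × conv₂ m n ≡ w)
    accepts w = mk⇔ ⇒ ⇐
      where
      ⇒ : Final (foldl δ (level , s₀) w) → ∃₂ λ m n → X m n × conv₂ m n ≡ w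
      ⇒ f with m , n , refl ← word-level w s₀ f
        with k , goal ← to (final-level m n s₀) f =
        m , n , sound m n (suc (m ⊔ n) + k) goal , refl
      ⇐ : (∃₂ λ m n → X m n × conv₂ m n ≡ w) → Final (foldl δ (level , s₀) w)
      ⇐ (m , n , x , refl) with t₀ , goal ← complete m n x =
        from (final-level m n s₀) (t₀ , goal _ (m≤n+m t₀ (suc (m ⊔ n))))

-- Reachability in labelled graphs

module Reachability {V : Set} (E : Rel V 0ℓ) where

  infixr 5 _∷⟨_⟩_

  data Path (D : Pred V 0ℓ) : Rel V 0ℓ where
    stop     : ∀ {u} → D u → Path D u u
    _∷⟨_⟩_ : ∀ {u w v} → D u → E u w → Path D w v → Path D u v

  private
    variable
      D D′ : Pred V 0ℓ
      u v w : V

  source : Path D u v → D u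
  source (stop d)      = d
  source (d ∷⟨ _ ⟩ _) = d

  target : Path D u v → D v
  target (stop d)      = d
  target (_ ∷⟨ _ ⟩ p) = target p

  weaken : (∀ {u} → D u → D′ u) → Path D u v → Path D′ u v
  weaken D⊆D′ (stop d)      = stop (D⊆D′ d)
  weaken D⊆D′ (d ∷⟨ e ⟩ p) = D⊆D′ d ∷⟨ e ⟩ weaken D⊆D′ p

  _++_ : Path D u w → Path D w v → Path D u v
  stop _          ++ q = q
  (d ∷⟨ e ⟩ p) ++ q = d ∷⟨ e ⟩ (p ++ q)

  module Insert {D D′ : Pred V 0ℓ} {z : V} (D′⇔ : ∀ {v} → D′ v ⇔ (D v ⊎ v ≡ z)) where

    To From : Pred V 0ℓ
    To   u = u ≡ z ⊎ (∃[ w ] Path D u w × E w z)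
    From v = v ≡ z ⊎ (∃[ w ] E z w × Path D w v)

    -- If the inserted vertex is visited, the part before its first visit yields `To u` and the part
    -- after its last visit yields `From v`; everything in between is dropped.
    split : Path D′ u v → Path D u v ⊎ (To u × From v)
    split (stop d) with to D′⇔ d
    ... | inj₁ d′   = inj₁ (stop d′)
    ... | inj₂ refl = inj₂ (inj₁ refl , inj₁ refl)
    split (d ∷⟨ e ⟩ p) with to D′⇔ d | split p
    ... | inj₁ d′   | inj₁ q                          = inj₁ (d′ ∷⟨ e ⟩ q)
    ... | inj₁ d′   | inj₂ (inj₁ refl , f)            = inj₂ (inj₂ (_ , stop d′ , e) , f)
    ... | inj₁ d′   | inj₂ (inj₂ (w , q , e′) , f)    = inj₂ (inj₂ (w , d′ ∷⟨ e ⟩ q , e′) , f)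
    ... | inj₂ refl | inj₁ q                          = inj₂ (inj₁ refl , inj₂ (_ , e , q))
    -- The path starts at `z` and returns to it: the loop is discarded.
    ... | inj₂ refl | inj₂ (_ , f)                    = inj₂ (inj₁ refl , f)

    old : Path D u v → Path D′ u v
    old = weaken (from D′⇔ ∘ inj₁)

    toPath : To u → Path D′ u z
    toPath (inj₁ refl)        = stop (from D′⇔ (inj₂ refl))
    toPath (inj₂ (_ , p , e)) = old p ++ (from D′⇔ (inj₁ (target p)) ∷⟨ e ⟩ stop (from D′⇔ (inj₂ refl)))

    fromPath : From v → Path D′ z v
    fromPath (inj₁ refl)        = stop (from D′⇔ (inj₂ refl))
    fromPath (inj₂ (_ , e , p)) = from D′⇔ (inj₂ refl) ∷⟨ e ⟩ old p

    join : Path D u v ⊎ (To u × From v) → Path D′ u v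
    join (inj₁ p)       = old p
    join (inj₂ (p , q)) = toPath p ++ fromPath q

-- Relations on Fin k, encoded as elements of a finite set

FinRel : ℕ → Set
FinRel k = Fin (2 ^ (k * k))

module _ {k : ℕ} where

  Holds : FinRel k → Rel (Fin k) 0ℓ
  Holds p l l′ = finToFun {2} {k * k} p (combine l l′) ≡ 1F

  holds? : ∀ p l l′ → Dec (Holds p l l′)
  holds? p l l′ = _ ≟ _

  module _ {Q : Rel (Fin k) 0ℓ} (Q? : ∀ l l′ → Dec (Q l l′)) where

    bit : Fin k × Fin k → Fin 2
    bit (l , l′) = if does (Q? l l′) then 1F else 0F

    finRel : FinRel k
    finRel = funToFin (bit ∘ remQuot {k} k)

    holds-finRel : ∀ l l′ → Holds finRel l l′ ⇔ Q l l′
    holds-finRel l l′ = mk⇔ (bit⇒Q ∘ trans (sym eq)) (trans eq ∘ Q⇒bit)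
      where
      eq : finToFun {2} {k * k} finRel (combine l l′) ≡ bit (l , l′)
      eq = trans (finToFun-funToFin (bit ∘ remQuot {k} k) (combine l l′)) (cong bit (remQuot-combine l l′))
      bit⇒Q : bit (l , l′) ≡ 1F → Q l l′
      bit⇒Q _ with yes q ← Q? l l′ = q
      Q⇒bit : Q l l′ → bit (l , l′) ≡ 1F
      Q⇒bit q rewrite dec-true (Q? l l′) q = refl

-- Reachability between label classes

module LabelledReachability
  {V : Set} (E : Rel V 0ℓ) {k : ℕ}
  {Out In : Pred (Fin k) 0ℓ} (out? : Decidable Out) (in? : Decidable In)
  where

  open Reachability E

  Represents : FinRel k → Pred V 0ℓ → (V → Fin k) → Set
  Represents p D c = ∀ l l′ → Holds p l l′ ⇔ (∃₂ λ u v → c u ≡ l × c v ≡ l′ × Path D u v)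

  empty : FinRel k
  empty = finRel {k} {λ _ _ → ⊥} (λ _ _ → no λ ())

  empty-represents : ∀ {D} c → (∀ {v} → D v → ⊥) → Represents empty D c
  empty-represents {D} c D-empty l l′ = mk⇔
    (λ h → ⊥-elim (to (holds-finRel {k} {λ _ _ → ⊥} (λ _ _ → no λ ()) l l′) h))
    (λ (_ , _ , _ , _ , p) → ⊥-elim (D-empty (source p)))

  Inserted : FinRel k → Fin k → Rel (Fin k) 0ℓ
  Inserted p z l l′ = Holds p l l′ ⊎
    ((l  ≡ z ⊎ (∃[ b ] Holds p l b × Out b)) ×
     (l′ ≡ z ⊎ (∃[ b ] In b × Holds p b l′)))

  inserted? : ∀ p z l l′ → Dec (Inserted p z l l′)
  inserted? p z l l′ = holds? p l l′ ⊎-dec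
    ((l  ≟ z ⊎-dec any? (λ b → holds? p l b ×-dec out? b)) ×-dec
     (l′ ≟ z ⊎-dec any? (λ b → in? b ×-dec holds? p b l′)))

  insert : Fin k → FinRel k → FinRel k
  insert z p = finRel (inserted? p z)

  -- Labels determine the edges to and from `z`, so any vertices witnessing a label pair serve
  -- equally well. The witnesses for the two halves of a path can be chosen independently, because
  -- the halves meet at `z` itself.
  insert-represents : ∀ {D D′ c z p} → (∀ {v} → D′ v ⇔ (D v ⊎ v ≡ z)) →
    (∀ {u} → D u → E u z ⇔ Out (c u)) → (∀ {u} → D u → E z u ⇔ In (c u)) →
    Represents p D c → Represents (insert (c z) p) D′ c
  insert-represents {D} {D′} {c} {z} {p} D′⇔ out⇔ in⇔ rep l l′ =
    mk⇔ (sound ∘ to (holds-finRel (inserted? p (c z)) l l′)) (from (holds-finRel (inserted? p (c z)) l l′) ∘ complete)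
    where
    open Insert D′⇔

    soundTo : ∀ {l} → (l ≡ c z ⊎ (∃[ b ] Holds p l b × Out b)) → ∃[ u ] c u ≡ l × To u
    soundTo (inj₁ refl) = z , refl , inj₁ refl
    soundTo (inj₂ (b , h , o)) with u , w , refl , refl , q ← to (rep _ b) h =
      u , refl , inj₂ (w , q , from (out⇔ (target q)) o)

    soundFrom : ∀ {l} → (l ≡ c z ⊎ (∃[ b ] In b × Holds p b l)) → ∃[ v ] c v ≡ l × From v
    soundFrom (inj₁ refl) = z , refl , inj₁ refl
    soundFrom (inj₂ (b , i , h)) with w , v , refl , refl , q ← to (rep b _) h =
      v , refl , inj₂ (w , from (in⇔ (source q)) i , q)

    sound : Inserted p (c z) l l′ → ∃₂ λ u v → c u ≡ l × c v ≡ l′ × Path D′ u v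
    sound (inj₁ h) with u , v , eq , eq′ , q ← to (rep l l′) h = u , v , eq , eq′ , join (inj₁ q)
    sound (inj₂ (t , f)) with u , eq , t′ ← soundTo t | v , eq′ , f′ ← soundFrom f =
      u , v , eq , eq′ , join (inj₂ (t′ , f′))

    completeTo : ∀ {u} → To u → c u ≡ c z ⊎ (∃[ b ] Holds p (c u) b × Out b)
    completeTo (inj₁ refl) = inj₁ refl
    completeTo (inj₂ (w , q , e)) = inj₂ (c w , from (rep _ _) (_ , w , refl , refl , q) , to (out⇔ (target q)) e)

    completeFrom : ∀ {v} → From v → c v ≡ c z ⊎ (∃[ b ] In b × Holds p b (c v))
    completeFrom (inj₁ refl) = inj₁ refl
    completeFrom (inj₂ (w , e , q)) = inj₂ (c w , to (in⇔ (source q)) e , from (rep _ _) (w , _ , refl , refl , q))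

    complete : (∃₂ λ u v → c u ≡ l × c v ≡ l′ × Path D′ u v) → Inserted p (c z) l l′
    complete (u , v , refl , refl , q) with split q
    ... | inj₁ q′      = inj₁ (from (rep _ _) (u , v , refl , refl , q′))
    ... | inj₂ (t , f) = inj₂ (completeTo t , completeFrom f)

  Relabelled : (Fin k → Fin k) → FinRel k → Rel (Fin k) 0ℓ
  Relabelled f p l l′ = ∃₂ λ b b′ → f b ≡ l × f b′ ≡ l′ × Holds p b b′

  relabelled? : ∀ f p l l′ → Dec (Relabelled f p l l′)
  relabelled? f p l l′ = any? λ b → any? λ b′ → (f b ≟ l) ×-dec (f b′ ≟ l′) ×-dec holds? p b b′

  relabel : (Fin k → Fin k) → FinRel k → FinRel k
  relabel f p = finRel (relabelled? f p)

  relabel-represents : ∀ {D c c′ f p} → (∀ {u} → D u → c′ u ≡ f (c u)) →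
    Represents p D c → Represents (relabel f p) D c′
  relabel-represents {D} {c} {c′} {f} {p} c′≡f∘c rep l l′ =
    mk⇔ (sound ∘ to (holds-finRel (relabelled? f p) l l′)) (from (holds-finRel (relabelled? f p) l l′) ∘ complete)
    where
    sound : Relabelled f p l l′ → ∃₂ λ u v → c′ u ≡ l × c′ v ≡ l′ × Path D u v
    sound (b , b′ , refl , refl , h) with u , v , refl , refl , q ← to (rep b b′) h =
      u , v , c′≡f∘c (source q) , c′≡f∘c (target q) , q

    complete : (∃₂ λ u v → c′ u ≡ l × c′ v ≡ l′ × Path D u v) → Relabelled f p l l′
    complete (u , v , refl , refl , q) =
      c u , c v , sym (c′≡f∘c (source q)) , sym (c′≡f∘c (target q)) , from (rep _ _) (u , v , refl , refl , q)

  represents-⇔ : ∀ {D D′ c p} → (∀ {v} → D′ v ⇔ D v) → Represents p D c → Represents p D′ c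
  represents-⇔ D′⇔D rep l l′ = mk⇔
    (λ h → let u , v , eq , eq′ , q = to (rep l l′) h in u , v , eq , eq′ , weaken (from D′⇔D) q)
    (λ (u , v , eq , eq′ , q) → from (rep l l′) (u , v , eq , eq′ , weaken (to D′⇔D) q))

-- Automaton for the transitive closure of an automatic graph on the numbers

module TransitiveClosure (M : DFA Letter) where

  open DFA M

  state : ℕ → ℕ → Fin states
  state m n = foldl step start (conv₂ m n)

  E : Rel ℕ 0ℓ
  E m n = state m n ∈ₛ final

  -- Passing from `t` to `suc t` appends a single letter to the convolution, here and in the next
  -- two lemmas. That letter does not depend on `v`, which is why labels evolve independently of it.
  state-diagonal : ∀ t → state (suc t) (suc t) ≡ step (state t t) aa
  state-diagonal = go start
    where
    go : ∀ q t → foldl step q (conv₂ (suc t) (suc t)) ≡ step (foldl step q (conv₂ t t)) aa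
    go q zero    = refl
    go q (suc t) = go (step q aa) t

  state-sucʳ : ∀ {v t} → v ≤ t → state v (suc t) ≡ step (state v t) $a
  state-sucʳ = go start
    where
    go : ∀ q {v t} → v ≤ t → foldl step q (conv₂ v (suc t)) ≡ step (foldl step q (conv₂ v t)) $a
    go q {t = zero}  z≤n       = refl
    go q {t = suc t} z≤n       = go (step q $a) {t = t} z≤n
    go q             (s≤s v≤t) = go (step q aa) v≤t

  state-sucˡ : ∀ {v t} → v ≤ t → state (suc t) v ≡ step (state t v) a$
  state-sucˡ = go start
    where
    go : ∀ q {v t} → v ≤ t → foldl step q (conv₂ (suc t) v) ≡ step (foldl step q (conv₂ t v)) a$
    go q {t = zero}  z≤n       = refl
    go q {t = suc t} z≤n       = go (step q a$) {t = t} z≤n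
    go q             (s≤s v≤t) = go (step q aa) v≤t

  labels : ℕ
  labels = states * states * 3

  label : Fin states → Fin states → Fin 3 → Fin labels
  label o i m = combine (combine o i) m

  statesOf : Fin labels → Fin states × Fin states
  statesOf l = remQuot {states} states (proj₁ (remQuot {states * states} 3 l))

  outState inState : Fin labels → Fin states
  outState = proj₁ ∘ statesOf
  inState  = proj₂ ∘ statesOf

  markOf : Fin labels → Fin 3
  markOf l = proj₂ (remQuot {states * states} 3 l)

  statesOf-label : ∀ o i m → statesOf (label o i m) ≡ (o , i)
  statesOf-label o i m = trans (cong (remQuot {states} states ∘ proj₁) (remQuot-combine (combine o i) m)) (remQuot-combine o i)

  outState-label : ∀ o i m → outState (label o i m) ≡ o
  outState-label o i m = cong proj₁ (statesOf-label o i m)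

  inState-label : ∀ o i m → inState (label o i m) ≡ i
  inState-label o i m = cong proj₂ (statesOf-label o i m)

  markOf-label : ∀ o i m → markOf (label o i m) ≡ m
  markOf-label o i m = cong proj₂ (remQuot-combine (combine o i) m)

  age : Fin labels → Fin labels
  age l = label (step (outState l) $a) (step (inState l) a$) (markOf l)

  age-label : ∀ o i m → age (label o i m) ≡ label (step o $a) (step i a$) m
  age-label o i m rewrite outState-label o i m | inState-label o i m | markOf-label o i m = refl

  -- (v , true) is the additional copy of v.
  V : Set
  V = ℕ × Bool

  _↝_ : Rel V 0ℓ
  (u , _) ↝ (v , _) = E u v

  open Reachability _↝_
  open LabelledReachability _↝_ (λ l → outState l ∈ₛ? final) (λ l → inState l ∈ₛ? final)

  pattern none   = 0F
  pattern first  = 1F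
  pattern second = 2F

  mark : Bool → Fin 3
  mark isX = if isX then first else none

  State : Set
  State = Fin states × FinRel labels

  addCopy : Bool → Fin states → FinRel labels → FinRel labels
  addCopy isY q p = if isY then insert (label q q second) p else p

  advance : Bool → Bool → State → State
  -- A new vertex has `q` as both of its states, being compared with itself. Its copy comes second,
  -- so that a loop at `t` counts as an edge from `t` to the copy. Finally all labels pass to time
  -- `suc t`.
  advance isX isY (q , p) = step q aa , relabel age (addCopy isY q (insert (label q q (mark isX)) p))

  Goal : Pred State 0ℓ
  Goal (q , p) = ∃₂ λ l l′ → markOf l ≡ first × markOf l′ ≡ second × Holds p l l′

  goal? : Decidable Goal
  goal? (q , p) = any? λ l → any? λ l′ → (markOf l ≟ first) ×-dec (markOf l′ ≟ second) ×-dec holds? p l l′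

  open MarkedRun (↔-sym *↔×) advance goal?

  initial : State
  initial = start , empty

  module _ (x y : ℕ) where

    markV : V → Fin 3
    markV (v , false) = mark (v ≡ᵇ x)
    markV (v , true)  = second

    colour : ℕ → V → Fin labels
    colour t u@(v , _) = label (state v t) (state t v) (markV u)

    Present : ℕ → Pred V 0ℓ
    Present t (v , false) = v < t
    Present t (v , true)  = v < t × v ≡ y

    -- The vertex set between the two insertions at time `t`.
    PresentButCopy : ℕ → Pred V 0ℓ
    PresentButCopy t (v , false) = v < suc t
    PresentButCopy t (v , true)  = v < t × v ≡ y

    present⇒< : ∀ {t} u → Present t u → proj₁ u < t
    present⇒< (v , false) d       = d
    present⇒< (v , true)  (d , _) = d

    <-suc⇔ : ∀ {v t} → v < suc t ⇔ (v < t ⊎ v ≡ t)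
    <-suc⇔ = mk⇔ (λ { (s≤s v≤t) → m≤n⇒m<n∨m≡n v≤t }) λ { (inj₁ v<t) → m<n⇒m<1+n v<t ; (inj₂ refl) → n<1+n _ }

    insert-vertex : ∀ t {u} → PresentButCopy t u ⇔ (Present t u ⊎ u ≡ (t , false))
    insert-vertex t {v , false} = mk⇔
      (λ d → case to <-suc⇔ d of λ { (inj₁ v<t) → inj₁ v<t ; (inj₂ refl) → inj₂ refl })
      λ { (inj₁ v<t) → from <-suc⇔ (inj₁ v<t) ; (inj₂ refl) → n<1+n _ }
    insert-vertex t {v , true}  = mk⇔ inj₁ λ { (inj₁ d) → d ; (inj₂ ()) }

    insert-copy : ∀ t → t ≡ y → ∀ {u} → Present (suc t) u ⇔ (PresentButCopy t u ⊎ u ≡ (t , true))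
    insert-copy t refl {v , false} = mk⇔ inj₁ λ { (inj₁ d) → d ; (inj₂ ()) }
    insert-copy t refl {v , true}  = mk⇔ (λ { (_ , refl) → inj₂ refl })
      λ { (inj₁ (v<t , eq)) → m<n⇒m<1+n v<t , eq ; (inj₂ refl) → n<1+n _ , refl }

    no-copy : ∀ t → t ≢ y → ∀ {u} → Present (suc t) u ⇔ PresentButCopy t u
    no-copy t t≢y {v , false} = ⇔-id _
    no-copy t t≢y {v , true}  = mk⇔
      (λ { (d , refl) → case to <-suc⇔ d of λ { (inj₁ v<t) → v<t , refl ; (inj₂ refl) → contradiction refl t≢y } })
      λ { (v<t , eq) → m<n⇒m<1+n v<t , eq }

    Correct : ℕ → Pred State 0ℓ
    Correct t (q , p) = q ≡ state t t × Represents p (Present t) (colour t)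

    out⇔ : ∀ t u b → (u ↝ (t , b)) ⇔ (outState (colour t u) ∈ₛ final)
    out⇔ t u@(v , _) b rewrite outState-label (state v t) (state t v) (markV u) = ⇔-id _

    in⇔ : ∀ t u b → ((t , b) ↝ u) ⇔ (inState (colour t u) ∈ₛ final)
    in⇔ t u@(v , _) b rewrite inState-label (state v t) (state t v) (markV u) = ⇔-id _

    addCopy-represents : ∀ t {p} → Represents p (PresentButCopy t) (colour t) →
                         Represents (addCopy (t ≡ᵇ y) (state t t) p) (Present (suc t)) (colour t)
    -- Abstracting the test together with its two specifications leaves a proof of `t ≡ y` in one
    -- case and a refutation in the other.
    addCopy-represents t rep with t ≡ᵇ y | ≡ᵇ⇒≡ t y | ≡⇒≡ᵇ t y
    ... | true  | t≡y | _   = insert-represents {z = t , true} (insert-copy t (t≡y _)) (λ {u} _ → out⇔ t u true) (λ {u} _ → in⇔ t u true) rep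
    ... | false | _   | t≢y = represents-⇔ (no-copy t t≢y) rep

    colour-suc : ∀ t u → Present (suc t) u → colour (suc t) u ≡ age (colour t u)
    colour-suc t u@(v , _) d with s≤s v≤t ← present⇒< u d =
      trans (cong₂ (λ o i → label o i (markV u)) (state-sucʳ v≤t) (state-sucˡ v≤t))
            (sym (age-label (state v t) (state t v) (markV u)))

    advance-correct : ∀ t s → Correct t s → Correct (suc t) (advance (t ≡ᵇ x) (t ≡ᵇ y) s)
    advance-correct t (_ , p) (refl , rep) = sym (state-diagonal t) ,
      relabel-represents (λ {u} → colour-suc t u)
        (addCopy-represents t
          (insert-represents {z = t , false} (insert-vertex t) (λ {u} _ → out⇔ t u false) (λ {u} _ → in⇔ t u false) rep))

    -- The invariant of the run, from which both soundness and completeness are read off.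
    run-correct : ∀ t → Correct t (run (at x) (at y) initial t)
    run-correct zero    = refl , empty-represents (colour 0) (λ {u} d → case present⇒< u d of λ ())
    run-correct (suc t) rewrite run-suc (at x) (at y) initial t = advance-correct t _ (run-correct t)

    marked-first : ∀ u → markV u ≡ first → u ≡ (x , false)
    marked-first (v , false) eq with v ≡ᵇ x | ≡ᵇ⇒≡ v x
    ... | true | v≡x = cong (_, false) (v≡x _)

    marked-second : ∀ {t} u → markV u ≡ second → Present t u → u ≡ (y , true)
    marked-second (v , true)  eq (_ , refl) = refl
    marked-second (v , false) eq d with v ≡ᵇ x
    marked-second (v , false) () d | true
    marked-second (v , false) () d | false

    markV-x : markV (x , false) ≡ first
    markV-x with x ≡ᵇ x | ≡⇒≡ᵇ x x refl
    ... | true | _ = refl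

  path⇒closure : ∀ {D u v} → Path D u v → u ≡ v ⊎ TransClosure E (proj₁ u) (proj₁ v)
  path⇒closure (stop _) = inj₁ refl
  path⇒closure (_ ∷⟨ e ⟩ p) with path⇒closure p
  ... | inj₁ refl = inj₂ [ e ]
  ... | inj₂ c    = inj₂ (e ∷ c)

  -- The path runs through original vertices and enters the copy of `y` with its last edge. The
  -- bound exceeds every number on the chain, so all of them are present.
  closure⇒path : ∀ x {u y} → TransClosure E u y →
                 ∃[ t₀ ] ∀ t → t₀ ≤ t → Path (Present x y t) (u , false) (y , true)
  closure⇒path x {u} {y} [ e ] = suc u ⊔ suc y , λ t t₀≤t →
    ≤-trans (m≤m⊔n (suc u) (suc y)) t₀≤t ∷⟨ e ⟩ stop (≤-trans (m≤n⊔m (suc u) (suc y)) t₀≤t , refl)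
  closure⇒path x {u} (e ∷ c) with t₀ , path ← closure⇒path x c = suc u ⊔ t₀ , λ t ≤t →
    ≤-trans (m≤m⊔n (suc u) t₀) ≤t ∷⟨ e ⟩ path t (≤-trans (m≤n⊔m (suc u) t₀) ≤t)

  sound : ∀ x y t → Goal (run (at x) (at y) initial t) → TransClosure E x y
  sound x y t (l , l′ , eq , eq′ , h) with to (proj₂ (run-correct x y t) l l′) h
  ... | u , v , refl , refl , path
    with refl ← marked-first x y u (trans (sym (markOf-label _ _ (markV x y u))) eq)
       | refl ← marked-second x y v (trans (sym (markOf-label _ _ (markV x y v))) eq′) (target path)
    -- The ends `(x , false)` and `(y , true)` differ even if `x` is `y`, so the path has an edge.
    with inj₂ c ← path⇒closure path = c

  complete : ∀ x y → TransClosure E x y → ∃[ t₀ ] ∀ t → t₀ ≤ t → Goal (run (at x) (at y) initial t)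
  complete x y c with t₀ , path ← closure⇒path x c = t₀ , λ t t₀≤t →
    colour x y t (x , false) , colour x y t (y , true) ,
    trans (markOf-label _ _ (markV x y (x , false))) (markV-x x y) ,
    markOf-label _ _ second ,
    from (proj₂ (run-correct x y t) _ _) (_ , _ , refl , refl , path t t₀≤t)

  transClosureRegular : RegularOnℕ (TransClosure E)
  transClosureRegular = markedRunRegular initial sound complete

-- Transitive closures of regular relations on the numbers

TransClosure-map : {A : Set} {R : Rel A ℓ} {R′ : Rel A ℓ′} → (∀ {x y} → R x y → R′ x y) →
                   ∀ {x y} → TransClosure R x y → TransClosure R′ x y
TransClosure-map f [ r ]   = [ f r ]
TransClosure-map f (r ∷ c) = f r ∷ TransClosure-map f c

RegularOnℕ-cong : {X : Rel ℕ ℓ} {Y : Rel ℕ ℓ′} → (∀ {m n} → X m n ⇔ Y m n) → RegularOnℕ X → RegularOnℕ Y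
RegularOnℕ-cong X⇔Y = Regular-cong λ w → mk⇔
  (λ (m , n , p , eq) → m , n , to X⇔Y p , eq)
  (λ (m , n , p , eq) → m , n , from X⇔Y p , eq)

RegularOnℕ-⁺ : {X : Rel ℕ ℓ} → RegularOnℕ X → RegularOnℕ (TransClosure X)
RegularOnℕ-⁺ {X = X} (M , X⇔M) = RegularOnℕ-cong
  (mk⇔ (TransClosure-map (from edge)) (TransClosure-map (to edge))) (TransitiveClosure.transClosureRegular M)
  where
  edge : ∀ {m n} → X m n ⇔ TransitiveClosure.E M m n
  edge {m} {n} = mk⇔
    (λ p → to (X⇔M _) (m , n , p , refl))
    -- Acceptance provides some pair with the same convolution; by injectivity it is the given pair.
    (λ acc → case from (X⇔M (conv₂ m n)) acc of λ (m′ , n′ , p , eq) →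
      case conv₂-injective m′ n′ eq of λ { (refl , refl) → p })

-- Presentations over a*

module _ {𝒮 : Structure ℓ} (P : UnaryFAPresentation 𝒮) (L-universal : Universal (FAPresentation.L P)) where

  open FAPresentation P

  element : ℕ → Carrier 𝒮
  element m = φ (word m , [ L-universal (word m) ])

  element-surjective : ∀ s → ∃[ m ] element m ≡ s
  element-surjective s with (w , _) , hit ← φ-surjective s with m , refl ← word-surjective w = m , hit refl

  Onℕ : Pred (Vec (Carrier 𝒮) 2) ℓ → Rel ℕ ℓ
  Onℕ T m n = T (element m ∷ element n ∷ [])

  Λ⇔Onℕ : ∀ T w → (∃[ ws ] Λ T φ ws × conv ws ≡ w) ⇔ (∃₂ λ m n → Onℕ T m n × conv₂ m n ≡ w)
  Λ⇔Onℕ T w = mk⇔ ⇒ ⇐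
    where
    ⇒ : (∃[ ws ] Λ T φ ws × conv ws ≡ w) → ∃₂ λ m n → Onℕ T m n × conv₂ m n ≡ w
    ⇒ (u ∷ v ∷ [] , (_ ∷ _ ∷ [] , p) , eq)
      with m , refl ← word-surjective u | n , refl ← word-surjective v =
      m , n , p , trans (sym (conv-word m n)) eq
    ⇐ : (∃₂ λ m n → Onℕ T m n × conv₂ m n ≡ w) → ∃[ ws ] Λ T φ ws × conv ws ≡ w
    ⇐ (m , n , p , eq) = word m ∷ word n ∷ [] , (L-universal _ ∷ L-universal _ ∷ [] , p) , trans (conv-word m n) eq

  -- A chain in the structure lifts to a chain of numbers, because surjectivity of `φ` names every
  -- intermediate element.
  Onℕ-⁺ : ∀ R {m n} → TransClosure (Onℕ R) m n ⇔ Onℕ (R ⁺) m n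
  Onℕ-⁺ R = mk⇔ ⇒ (λ c → ⇐ c refl refl)
    where
    ⇒ : ∀ {m n} → TransClosure (Onℕ R) m n → Onℕ (R ⁺) m n
    ⇒ [ r ]   = [ r ]
    ⇒ (r ∷ c) = r ∷ ⇒ c
    -- The ends are arbitrary elements with equations, so that the chain can be matched on.
    ⇐ : ∀ {s s′ m n} → TransClosure (λ s s′ → R (s ∷ s′ ∷ [])) s s′ →
        s ≡ element m → s′ ≡ element n → TransClosure (Onℕ R) m n
    ⇐ [ r ] refl refl = [ r ]
    ⇐ (_∷_ {y = s} r c) refl eq with k , refl ← element-surjective s = r ∷ ⇐ c refl eq

  Λ-⁺-regular : ∀ R → RegularRelation (Λ R φ) → RegularRelation (Λ (R ⁺) φ)
  Λ-⁺-regular R reg = Regular-cong (λ w → ⇔-sym (Λ⇔Onℕ (R ⁺) w))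
    (RegularOnℕ-cong (Onℕ-⁺ R) (RegularOnℕ-⁺ (Regular-cong (Λ⇔Onℕ R) reg)))

augment-presentation : {𝒮 : Structure ℓ} (P : UnaryFAPresentation 𝒮) {R : Relation (Carrier 𝒮)} →
  RegularRelation (Λ (proj₂ R) (FAPresentation.φ P)) → UnaryFAPresentation (augment 𝒮 R)
augment-presentation P reg = record
  { L            = L
  ; L-regular    = L-regular
  ; φ            = φ
  ; φ-surjective = φ-surjective
  ; Λ-regular    = λ where
      (here refl)         → Λ-regular (here refl)
      (there (here refl)) → reg
      (there (there R∈))  → Λ-regular (there R∈)
  }
  where open FAPresentation P

theorem4p6 : ∀ {ℓ : Level} (𝒮 : Structure ℓ) (P : UnaryFAPresentation 𝒮) →
    Universal (FAPresentation.L P) →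
    Injective _≡_ _≡_ (FAPresentation.φ P) →
    (R : Pred (Vec (Carrier 𝒮) 2) ℓ) →
    (2 , R) ∈ relations 𝒮 →
    RegularRelation (Λ (R ⁺) (FAPresentation.φ P)) × UnaryFAPresentable (augment 𝒮 (2 , R ⁺))
theorem4p6 𝒮 P L-universal _ R R∈ = R⁺-regular , augment-presentation P R⁺-regular
  where
  R⁺-regular : RegularRelation (Λ (R ⁺) (FAPresentation.φ P))
  R⁺-regular = Λ-⁺-regular P L-universal R (FAPresentation.Λ-regular P (there R∈))
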